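{- For any graph $G$ (finite or infinite), the following are equivalent: (i) $\mathsf{P}(G)$ is a lattice; (ii) the closure $\varphi(\boldsymbol{u})$ of any open subset $\boldsymbol{u}$ of $\mathcal{C}(G)$ is open (i.e., $\mathsf{P}(G)=\mathsf{R}(G)$); (iii) $G$ is a block graph without $4$-cliques.
   Context: For a graph $G$, $\mathcal{C}(G)$ is the set of nonempty connected subsets of $G$. For $\boldsymbol{x}\subseteq\mathcal{C}(G)$, $\varphi(\boldsymbol{x})$ is the set of all $X\in\mathcal{C}(G)$ that are the disjoint union of some nonempty finite subset of $\boldsymbol{x}$; $\check\varphi(\boldsymbol{x})=\mathcal{C}(G)\setminus\varphi(\mathcal{C}(G)\setminus\boldsymbol{x})$. A subset is closed if $\varphi(\boldsymbol{x})=\boldsymbol{x}$, open if $\check\varphi(\boldsymbol{x})=\boldsymbol{x}$, regular closed if $\boldsymbol{x}=\varphi\check\varphi(\boldsymbol{x})$. $\mathsf{P}(G)$ is the poset of clopen (closed and open) subsets of $\mathcal{C}(G)$ and $\mathsf{R}(G)$ the lattice of regular closed subsets, both under inclusion. A block graph (not necessarily connected) is a graph in which every biconnected subset (connected and remaining connected after removal of any single vertex) is a clique; equivalently, no cycle $\mathcal{C}_n$ with $n\ge4$ and no diamond ($\mathcal{K}_4$ minus an edge) occurs as an induced subgraph. A $4$-clique is a complete subgraph on four vertices. -}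

module Defs where

open import Level using (Level; 0ℓ; Lift) renaming (suc to lsuc)
open import Data.Product using (Σ; ∃; ∃-syntax; _×_; _,_)
open import Data.List using (List; []; _∷_)
open import Data.Sum using (_⊎_)
open import Data.Empty using (⊥)
open import Data.Unit using (⊤)
open import Relation.Nullary using (¬_)
open import Relation.Binary.PropositionalEquality using (_≡_; _≢_)

record Graph : Set₁ where
  field
    V      : Set
    E      : V → V → Set
    E-sym  : ∀ {u v} → E u v → E v u
    E-irr  : ∀ {u} → ¬ E u u

module _ (G : Graph) where
  open Graph G

  VSet : Set₁
  VSet = V → Set

  _⊆ᵥ_ : VSet → VSet → Set
  X ⊆ᵥ Y = ∀ v → X v → Y v

  _≐ᵥ_ : VSet → VSet → Set
  X ≐ᵥ Y = (X ⊆ᵥ Y) × (Y ⊆ᵥ X)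

  -- walks staying inside X (the start vertex is assumed in X separately)
  data WalkIn (X : VSet) : V → V → Set where
    here : ∀ {u} → WalkIn X u u
    step : ∀ {u w v} → E u w → X w → WalkIn X w v → WalkIn X u v

  -- X induces a connected subgraph (the empty set counts vacuously)
  Connected : VSet → Set
  Connected X = ∀ u v → X u → X v → WalkIn X u v

  InC : VSet → Set
  InC X = (∃[ v ] X v) × Connected X

  Coll : Set₂
  Coll = VSet → Set₁

  _⊆_ : Coll → Coll → Set₁
  x ⊆ y = ∀ X → x X → y X

  _≐_ : Coll → Coll → Set₁
  x ≐ y = (x ⊆ y) × (y ⊆ x)

  IsColl : Coll → Set₁
  IsColl x = (∀ X → x X → InC X) × (∀ X Y → X ≐ᵥ Y → x X → x Y)

  ⋃ : List VSet → VSet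
  ⋃ [] v = ⊥
  ⋃ (X ∷ Xs) v = X v ⊎ ⋃ Xs v

  AllIn : Coll → List VSet → Set₁
  AllIn x [] = Lift (lsuc 0ℓ) ⊤
  AllIn x (X ∷ Xs) = x X × AllIn x Xs

  Disjoint : VSet → VSet → Set
  Disjoint X Y = ∀ v → X v → Y v → ⊥

  PairwiseDisjoint : List VSet → Set
  PairwiseDisjoint [] = ⊤
  PairwiseDisjoint (X ∷ Xs) = (∀ v → X v → ⋃ Xs v → ⊥) × PairwiseDisjoint Xs

  NonEmptyList : List VSet → Set
  NonEmptyList [] = ⊥
  NonEmptyList (_ ∷ _) = ⊤

  𝒞 : Coll
  𝒞 X = Lift (lsuc 0ℓ) (InC X)

  compl : Coll → Coll
  compl x X = InC X × ¬ x X

  φ : Coll → Coll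
  φ x X = InC X ×
          Σ (List VSet) (λ Xs →
            NonEmptyList Xs × AllIn x Xs × PairwiseDisjoint Xs × (⋃ Xs ≐ᵥ X))

  φ̌ : Coll → Coll
  φ̌ x = compl (φ (compl x))

  Closed : Coll → Set₁
  Closed x = φ x ≐ x

  Open : Coll → Set₁
  Open x = φ̌ x ≐ x

  InP : Coll → Set₁
  InP x = IsColl x × Closed x × Open x

  IsJoinP : Coll → Coll → Coll → Set₂
  IsJoinP x y z = InP z × x ⊆ z × y ⊆ z ×
                  (∀ w → InP w → x ⊆ w → y ⊆ w → z ⊆ w)

  IsMeetP : Coll → Coll → Coll → Set₂
  IsMeetP x y z = InP z × z ⊆ x × z ⊆ y ×
                  (∀ w → InP w → w ⊆ x → w ⊆ y → w ⊆ z)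

  PIsLattice : Set₂
  PIsLattice = ∀ x y → InP x → InP y →
               (∃[ z ] IsJoinP x y z) × (∃[ z ] IsMeetP x y z)

  ClosureOfOpenIsOpen : Set₂
  ClosureOfOpenIsOpen = ∀ u → IsColl u → Open u → Open (φ u)

  Biconnected : VSet → Set
  Biconnected X = InC X × (∀ v → X v → Connected (λ w → X w × w ≢ v))

  Clique : VSet → Set
  Clique X = ∀ u v → X u → X v → u ≢ v → E u v

  IsBlockGraph : Set₁
  IsBlockGraph = ∀ X → Biconnected X → Clique X

  -- a 4-clique: four (necessarily distinct, by irreflexivity) pairwise
  -- adjacent vertices
  Has4Clique : Set
  Has4Clique = ∃[ a ] ∃[ b ] ∃[ c ] ∃[ d ]
    (E a b × E a c × E a d × E b c × E b d × E c d)

  BlockGraphNo4Clique : Set₁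
  BlockGraphNo4Clique = IsBlockGraph × ¬ Has4Clique

{-# OPTIONS --safe #-}
module Submission where

-- A closed collection is already closed when it contains the connected unions
-- of two of its disjoint members, so only partitions into two parts matter.
--
-- (iii) ⇒ (ii): let Z be partitioned into members of an open u, and also into
-- two connected sets Y₁, Y₂.  Two edges from Y₁ to Y₂ lie on a common cycle,
-- hence span a clique.  So every part X meets Y₁ and Y₂ in connected sets, and
-- two parts meeting both Y₁ and Y₂ would yield a 4-clique.  At most one part is
-- therefore cut; openness of u puts one of its two halves in u, and the
-- corresponding Yᵢ is in φ u.
--
-- (ii) ⇒ (i): the join of x and y is φ (x ∪ y); meets come by complementation.
--
-- (i) ⇒ (iii): the connected subsets of X containing a point p form a clopen
-- collection star X p.  If X₁ ⊔ X₂ = Y₁ ⊔ Y₂ with all parts connected and all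
-- four cells Xᵢ ∩ Yⱼ nonempty, one point in each cell gives stars of X₁ and X₂
-- lying below the complements of stars of Y₁ and Y₂, and no clopen collection
-- fits in between.  Such a pair of partitions lives on every cycle with at least
-- four vertices, in particular on a 4-clique, and a biconnected set that is not
-- a clique contains such a cycle.

open import Defs
open import Data.Product using (_×_)
open import Function.Bundles using (_⇔_)
open import Axiom.ExcludedMiddle using (ExcludedMiddle)

open import Level using (0ℓ; Lift; lift) renaming (suc to lsuc)
open import Data.Empty using (⊥; ⊥-elim)
open import Data.Unit using (tt)
open import Data.Nat using (zero; suc)
open import Data.Nat.Properties using (suc-injective)
open import Data.Product using (∃-syntax; _,_; proj₁; proj₂)
import Data.Product as Product
open import Data.Sum using (_⊎_; inj₁; inj₂; [_,_]′)
import Data.Sum as Sum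
open import Data.List using (List; []; _∷_; _++_; length)
open import Data.List.Membership.Propositional using (_∈_; _∉_)
open import Data.List.Membership.Propositional.Properties using (∈-++⁺ˡ; ∈-++⁺ʳ; ∈-++⁻)
open import Data.List.Relation.Unary.Any using (here; there)
open import Data.List.Relation.Unary.All using (All; []; _∷_)
import Data.List.Relation.Unary.All as All
open import Data.List.Relation.Binary.Permutation.Propositional
  using (_↭_; refl; prep; swap; trans; ↭-sym)
open import Data.List.Relation.Binary.Permutation.Propositional.Properties using (↭-length)
open import Function using (_∘_; id)
open import Function.Bundles using (mk⇔)
open import Relation.Nullary using (¬_; yes; no; contradiction)
open import Relation.Nullary.Decidable using (decidable-stable)
open import Relation.Unary using (_∪_; _∩_)
open import Relation.Binary.PropositionalEquality using (_≡_; _≢_; refl; sym) renaming (trans to ≡-trans)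

module Proof (lem : ∀ {ℓ} → ExcludedMiddle ℓ) (G : Graph) where
  open Graph G

  private variable
    X Y Z : VSet G
    Xs Ys : List (VSet G)
    x y   : Coll G
    u v w z p q : V
    l m : List V

  -- Walks and connected sets

  walk-mono : _⊆ᵥ_ G X Y → WalkIn G X u v → WalkIn G Y u v
  walk-mono X⊆Y here = here
  walk-mono X⊆Y (step e Xw ws) = step e (X⊆Y _ Xw) (walk-mono X⊆Y ws)

  walk-++ : WalkIn G X u v → WalkIn G X v w → WalkIn G X u w
  walk-++ here ws = ws
  walk-++ (step e Xw vs) ws = step e Xw (walk-++ vs ws)

  walk-reverse : X u → WalkIn G X u v → WalkIn G X v u
  walk-reverse Xu here = here
  walk-reverse Xu (step e Xw ws) =
    walk-++ (walk-reverse Xw ws) (step (E-sym e) Xu here)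

  connected-from : (∀ w → X w → WalkIn G X w v) → Connected G X
  connected-from to-v a b Xa Xb = walk-++ (to-v a Xa) (walk-reverse Xb (to-v b Xb))

  connected-∪ : Connected G X → Connected G Y → X u → Y v → E u v →
                Connected G (X ∪ Y)
  connected-∪ {X} {Y} {u} {v} cX cY Xu Yv e = connected-from to-v
    where
    to-v : ∀ w → (X ∪ Y) w → WalkIn G (X ∪ Y) w v
    to-v w (inj₁ Xw) =
      walk-++ (walk-mono (λ _ → inj₁) (cX w u Xw Xu)) (step e (inj₂ Yv) here)
    to-v w (inj₂ Yw) = walk-mono (λ _ → inj₂) (cY w v Yw Yv)

  ≐ᵥ-sym : _≐ᵥ_ G X Y → _≐ᵥ_ G Y X
  ≐ᵥ-sym = Product.swap

  ≐ᵥ-trans : _≐ᵥ_ G X Y → _≐ᵥ_ G Y Z → _≐ᵥ_ G X Z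
  ≐ᵥ-trans (X⊆Y , Y⊆X) (Y⊆Z , Z⊆Y) =
    (λ v → Y⊆Z v ∘ X⊆Y v) , (λ v → Y⊆X v ∘ Z⊆Y v)

  InC-resp : _≐ᵥ_ G X Y → InC G X → InC G Y
  InC-resp (X⊆Y , Y⊆X) ((v , Xv) , cX) =
    (v , X⊆Y v Xv) , λ a b Ya Yb → walk-mono X⊆Y (cX a b (Y⊆X a Ya) (Y⊆X b Yb))

  -- Partitions as lists up to permutation

  ⋃-resp-↭ : Xs ↭ Ys → _⊆ᵥ_ G (⋃ G Xs) (⋃ G Ys)
  ⋃-resp-↭ refl v = id
  ⋃-resp-↭ (prep X ρ) v = Sum.map₂ (⋃-resp-↭ ρ v)
  ⋃-resp-↭ (swap X Y ρ) v (inj₁ Xv) = inj₂ (inj₁ Xv)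
  ⋃-resp-↭ (swap X Y ρ) v (inj₂ (inj₁ Yv)) = inj₁ Yv
  ⋃-resp-↭ (swap X Y ρ) v (inj₂ (inj₂ Xsv)) = inj₂ (inj₂ (⋃-resp-↭ ρ v Xsv))
  ⋃-resp-↭ (trans ρ σ) v = ⋃-resp-↭ σ v ∘ ⋃-resp-↭ ρ v

  ⋃-resp-↭⁻ : Xs ↭ Ys → _⊆ᵥ_ G (⋃ G Ys) (⋃ G Xs)
  ⋃-resp-↭⁻ ρ = ⋃-resp-↭ (↭-sym ρ)

  AllIn-resp-↭ : Xs ↭ Ys → AllIn G x Xs → AllIn G x Ys
  AllIn-resp-↭ refl a = a
  AllIn-resp-↭ (prep X ρ) (aX , a) = aX , AllIn-resp-↭ ρ a
  AllIn-resp-↭ (swap X Y ρ) (aX , aY , a) = aY , aX , AllIn-resp-↭ ρ a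
  AllIn-resp-↭ (trans ρ σ) = AllIn-resp-↭ σ ∘ AllIn-resp-↭ ρ

  PairwiseDisjoint-resp-↭ : Xs ↭ Ys → PairwiseDisjoint G Xs → PairwiseDisjoint G Ys
  PairwiseDisjoint-resp-↭ refl d = d
  PairwiseDisjoint-resp-↭ (prep X ρ) (dX , d) =
    (λ v Xv Ysv → dX v Xv (⋃-resp-↭⁻ ρ v Ysv)) , PairwiseDisjoint-resp-↭ ρ d
  PairwiseDisjoint-resp-↭ (swap X Y ρ) (dX , dY , d) =
    (λ { v Yv (inj₁ Xv) → dX v Xv (inj₁ Yv)
       ; v Yv (inj₂ Ysv) → dY v Yv (⋃-resp-↭⁻ ρ v Ysv) }) ,
    (λ v Xv Ysv → dX v Xv (inj₂ (⋃-resp-↭⁻ ρ v Ysv))) ,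
    PairwiseDisjoint-resp-↭ ρ d
  PairwiseDisjoint-resp-↭ (trans ρ σ) =
    PairwiseDisjoint-resp-↭ σ ∘ PairwiseDisjoint-resp-↭ ρ

  -- Parts are located by a point they contain; together with the `resp-↭` lemmas this lets any such
  -- part be treated as the head of the list.
  ⋃-member : (Xs : List (VSet G)) → ⋃ G Xs v →
             ∃[ Y ] ∃[ Ys ] (Xs ↭ Y ∷ Ys × Y v)
  ⋃-member (X ∷ Xs) (inj₁ Xv) = X , Xs , refl , Xv
  ⋃-member (X ∷ Xs) (inj₂ Xsv) with ⋃-member Xs Xsv
  ... | Y , Ys , ρ , Yv = Y , X ∷ Ys , trans (prep X ρ) (swap X Y refl) , Yv

  ⋃-nonempty : (Xs : List (VSet G)) → ⋃ G Xs v → NonEmptyList G Xs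
  ⋃-nonempty (X ∷ Xs) _ = tt

  AllIn-mono : _⊆_ G x y → (Xs : List (VSet G)) → AllIn G x Xs → AllIn G y Xs
  AllIn-mono x⊆y [] a = lift tt
  AllIn-mono x⊆y (X ∷ Xs) (xX , a) = x⊆y X xX , AllIn-mono x⊆y Xs a

  AllIn-++ : (Xs : List (VSet G)) → AllIn G x Xs → AllIn G x Ys → AllIn G x (Xs ++ Ys)
  AllIn-++ [] _ b = b
  AllIn-++ (X ∷ Xs) (xX , a) b = xX , AllIn-++ Xs a b

  ⋃-++⁺ : (Xs : List (VSet G)) → _⊆ᵥ_ G (⋃ G Xs ∪ ⋃ G Ys) (⋃ G (Xs ++ Ys))
  ⋃-++⁺ [] v (inj₂ Ysv) = Ysv
  ⋃-++⁺ (X ∷ Xs) v (inj₁ (inj₁ Xv)) = inj₁ Xv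
  ⋃-++⁺ (X ∷ Xs) v (inj₁ (inj₂ Xsv)) = inj₂ (⋃-++⁺ Xs v (inj₁ Xsv))
  ⋃-++⁺ (X ∷ Xs) v (inj₂ Ysv) = inj₂ (⋃-++⁺ Xs v (inj₂ Ysv))

  ⋃-++⁻ : (Xs : List (VSet G)) → _⊆ᵥ_ G (⋃ G (Xs ++ Ys)) (⋃ G Xs ∪ ⋃ G Ys)
  ⋃-++⁻ [] v = inj₂
  ⋃-++⁻ (X ∷ Xs) v (inj₁ Xv) = inj₁ (inj₁ Xv)
  ⋃-++⁻ (X ∷ Xs) v (inj₂ XsYsv) = Sum.map₁ inj₂ (⋃-++⁻ Xs v XsYsv)

  PairwiseDisjoint-++ : (Xs : List (VSet G)) →
    PairwiseDisjoint G Xs → PairwiseDisjoint G Ys →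
    Disjoint G (⋃ G Xs) (⋃ G Ys) → PairwiseDisjoint G (Xs ++ Ys)
  PairwiseDisjoint-++ [] _ e _ = e
  PairwiseDisjoint-++ (X ∷ Xs) (dX , d) e dis =
    (λ v Xv XsYsv → [ dX v Xv , dis v (inj₁ Xv) ]′ (⋃-++⁻ Xs v XsYsv)) ,
    PairwiseDisjoint-++ Xs d e (λ v → dis v ∘ inj₂)

  -- The closure operator

  φ-mono : _⊆_ G x y → _⊆_ G (φ G x) (φ G y)
  φ-mono x⊆y X (cX , Xs , ne , a , rest) = cX , Xs , ne , AllIn-mono x⊆y Xs a , rest

  φ-single : InC G X → x X → φ G x X
  φ-single {X} cX xX =
    cX , X ∷ [] , tt , (xX , lift tt) , ((λ _ _ ()) , tt) ,
    (λ { v (inj₁ Xv) → Xv }) , (λ v → inj₁)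

  φ-pair : x X → x Y → Disjoint G X Y → InC G Z → _≐ᵥ_ G (X ∪ Y) Z → φ G x Z
  φ-pair {X = X} {Y} xX xY dis cZ (XY⊆Z , Z⊆XY) =
    cZ , X ∷ Y ∷ [] , tt , (xX , xY , lift tt) ,
    ((λ { v Xv (inj₁ Yv) → dis v Xv Yv }) , (λ _ _ ()) , tt) ,
    (λ { v (inj₁ Xv) → XY⊆Z v (inj₁ Xv) ; v (inj₂ (inj₁ Yv)) → XY⊆Z v (inj₂ Yv) }) ,
    (λ v Zv → Sum.map₂ inj₁ (Z⊆XY v Zv))

  φ-∪ : φ G x X → φ G x Y → Disjoint G X Y → InC G (X ∪ Y) → φ G x (X ∪ Y)
  φ-∪ ((( v , Xv) , _) , Xs , _ , a , d , ⋃⊆X , X⊆⋃)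
      (_ , Ys , _ , b , e , ⋃⊆Y , Y⊆⋃) dis cXY =
    cXY , Xs ++ Ys , ⋃-nonempty (Xs ++ Ys) (⋃-++⁺ Xs v (inj₁ (X⊆⋃ v Xv))) ,
    AllIn-++ Xs a b ,
    PairwiseDisjoint-++ Xs d e (λ w Xsw Ysw → dis w (⋃⊆X w Xsw) (⋃⊆Y w Ysw)) ,
    (λ w → Sum.map (⋃⊆X w) (⋃⊆Y w) ∘ ⋃-++⁻ Xs w) ,
    (λ w → ⋃-++⁺ Xs w ∘ Sum.map (X⊆⋃ w) (Y⊆⋃ w))

  φ-isColl : IsColl G (φ G x)
  φ-isColl =
    (λ X → proj₁) ,
    λ { X Y X≐Y (cX , Xs , ne , a , d , ⋃≐X) →
        InC-resp X≐Y cX , Xs , ne , a , d , ≐ᵥ-trans ⋃≐X X≐Y }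

  compl-isColl : IsColl G x → IsColl G (compl G x)
  compl-isColl (_ , resp) =
    (λ X → proj₁) ,
    λ { X Y X≐Y (cX , ¬xX) → InC-resp X≐Y cX , ¬xX ∘ resp Y X (≐ᵥ-sym X≐Y) }

  ⊆φ : IsColl G x → _⊆_ G x (φ G x)
  ⊆φ (inC , _) X xX = φ-single (inC X xX) xX

  -- Reduction to partitions into two parts

  dne : ∀ {ℓ} {P : Set ℓ} → ¬ ¬ P → P
  dne = decidable-stable lem

  exit-edge : ∀ {P : V → Set} → X u → P u → ¬ P v → WalkIn G X u v →
              ∃[ a ] ∃[ b ] (X a × P a × X b × ¬ P b × E a b)
  exit-edge Xu Pu ¬Pv here = contradiction Pu ¬Pv
  exit-edge {u = u} {P = P} Xu Pu ¬Pv (step {w = w} e Xw ws) with lem {P = P w}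
  ... | yes Pw = exit-edge Xw Pw ¬Pv ws
  ... | no ¬Pw = u , w , Xu , Pu , Xw , ¬Pw , e

  -- An edge leaving the first part leads into another part Y; replace both by
  -- their union.
  ⋃∈-binary-closed : IsColl G x →
    (∀ X Y → x X → x Y → Disjoint G X Y → InC G (X ∪ Y) → x (X ∪ Y)) →
    ∀ n X Xs → length Xs ≡ n → x X → AllIn G x Xs → PairwiseDisjoint G (X ∷ Xs) →
    Connected G (⋃ G (X ∷ Xs)) → x (⋃ G (X ∷ Xs))
  ⋃∈-binary-closed (_ , resp) _ zero X [] _ xX _ _ _ =
    resp X _ ((λ _ → inj₁) , (λ _ → [ id , ⊥-elim ]′)) xX
  ⋃∈-binary-closed {x} coll@(inC , resp) bin (suc n) X (W ∷ Xs) len xX a@(xW , _) d@(dX , dXs) con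
    with inC X xX | inC W xW
  ... | (p , Xp) , cX | (q , Wq) , _
    with exit-edge {P = X} (inj₁ Xp) Xp (λ Xq → dX q Xq (inj₁ Wq))
           (con p q (inj₁ Xp) (inj₂ (inj₁ Wq)))
  ... | _ , b , _ , _ , inj₁ Xb , ¬Xb , _ = contradiction Xb ¬Xb
  ... | a′ , b , _ , Xa′ , inj₂ Xsb , _ , e with ⋃-member (W ∷ Xs) Xsb
  ... | Y , Ys , ρ , Yb
    with AllIn-resp-↭ ρ a | PairwiseDisjoint-resp-↭ (prep X ρ) d
  ... | xY , aYs | dX′ , dY , dYs =
    resp _ _ merged≐
      (⋃∈-binary-closed coll bin n (X ∪ Y) Ys
        -- The recursion runs on the length, since `Ys` is only a permuted remainder of the list and
        -- not a structural tail.
        (suc-injective (≡-trans (sym (↭-length ρ)) len))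
        (bin X Y xX xY (λ v Xv Yv → dX′ v Xv (inj₁ Yv))
          ((p , inj₁ Xp) , connected-∪ cX (proj₂ (inC Y xY)) Xa′ Yb e))
        aYs
        ((λ { v (inj₁ Xv) Ysv → dX′ v Xv (inj₂ Ysv) ; v (inj₂ Yv) Ysv → dY v Yv Ysv }) , dYs)
        (λ s t s∈ t∈ → walk-mono (proj₂ merged≐)
          (con s t (proj₁ merged≐ s s∈) (proj₁ merged≐ t t∈))))
    where
    merged≐ : _≐ᵥ_ G (⋃ G ((X ∪ Y) ∷ Ys)) (⋃ G (X ∷ W ∷ Xs))
    merged≐ =
      (λ v → ⋃-resp-↭⁻ (prep X ρ) v ∘ Sum.assocʳ) ,
      (λ v → Sum.assocˡ ∘ ⋃-resp-↭ (prep X ρ) v)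

  φ⊆-binary-closed : IsColl G x →
    (∀ X Y → x X → x Y → Disjoint G X Y → InC G (X ∪ Y) → x (X ∪ Y)) →
    _⊆_ G (φ G x) x
  φ⊆-binary-closed coll bin Z (cZ , X ∷ Xs , _ , (xX , a) , d , ⋃≐Z) =
    proj₂ coll _ Z ⋃≐Z
      (⋃∈-binary-closed coll bin (length Xs) X Xs refl xX a d
        (proj₂ (InC-resp (≐ᵥ-sym ⋃≐Z) cZ)))

  φ-closed : Closed G (φ G x)
  φ-closed = φ⊆-binary-closed φ-isColl (λ X Y → φ-∪) , ⊆φ φ-isColl

  -- Open and clopen collections

  φ̌⊆ : _⊆_ G (φ̌ G x) x
  φ̌⊆ X (cX , ¬φX) = dne λ ¬xX → ¬φX (φ-single cX (cX , ¬xX))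

  -- If neither half were in `x`, the two would partition `Z` inside the complement of `x`, which
  -- openness forbids.
  open-split : Open G x → x Z → InC G X → InC G Y → Disjoint G X Y →
               _≐ᵥ_ G (X ∪ Y) Z → x X ⊎ x Y
  open-split {x} {Z} {X} {Y} (_ , x⊆φ̌) xZ cX cY dis XY≐Z = dne λ ¬XY →
    let cZ , ¬φZ = x⊆φ̌ Z xZ in
    ¬φZ (φ-pair {X = X} {Y = Y} (cX , ¬XY ∘ inj₁) (cY , ¬XY ∘ inj₂) dis cZ XY≐Z)

  -- Complementation exchanges closedness and openness; excluded middle removes the double
  -- complement in the second exchange.
  compl-inP : InP G x → InP G (compl G x)
  compl-inP {x} (coll@(inC , _) , (φx⊆x , _) , _ , x⊆φ̌x) =
    compl-isColl coll ,
    ((λ X φX → proj₁ φX , λ xX → proj₂ (x⊆φ̌x X xX) φX) , ⊆φ (compl-isColl coll)) ,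
    φ̌⊆ ,
    λ X (cX , ¬xX) → cX ,
      ¬xX ∘ φx⊆x X ∘ φ-mono (λ Y (cY , ¬¬xY) → dne λ ¬xY → ¬¬xY (cY , ¬xY)) X

  -- Clopen stars

  star : VSet G → V → Coll G
  star X p W = Lift (lsuc 0ℓ) (InC G W × _⊆ᵥ_ G W X × W p)

  star-isColl : IsColl G (star X p)
  star-isColl {p = p} =
    (λ { W (lift (cW , _)) → cW }) ,
    λ { W W′ W≐W′ (lift (cW , W⊆X , Wp)) →
        lift (InC-resp W≐W′ cW , (λ v → W⊆X v ∘ proj₂ W≐W′ v) , proj₁ W≐W′ p Wp) }

  -- Two members share `p` and so are never disjoint: the two-part criterion holds vacuously.
  star-closed : Closed G (star X p)
  star-closed {X} {p} =
    φ⊆-binary-closed star-isColl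
      (λ { _ _ (lift (_ , _ , Yp)) (lift (_ , _ , Y′p)) dis _ → ⊥-elim (dis p Yp Y′p) }) ,
    ⊆φ star-isColl

  -- In a partition of a member, the part through `p` is again a member, so the parts cannot all
  -- come from the complement.
  star-open : Open G (star X p)
  star-open {X} {p} = φ̌⊆ , λ { W (lift (cW , W⊆X , Wp)) → cW , no-partition W⊆X Wp }
    where
    no-partition : ∀ {W} → _⊆ᵥ_ G W X → W p → ¬ φ G (compl G (star X p)) W
    no-partition W⊆X Wp (_ , Xs , _ , a , _ , ⋃⊆W , W⊆⋃) with ⋃-member Xs (W⊆⋃ p Wp)
    ... | Y , Ys , ρ , Yp with AllIn-resp-↭ {x = compl G (star X p)} ρ a
    ... | (cY , ¬sY) , _ =
      ¬sY (lift (cY , (λ v → W⊆X v ∘ ⋃⊆W v ∘ ⋃-resp-↭⁻ ρ v ∘ inj₁) , Yp))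

  star-inP : InP G (star X p)
  star-inP = star-isColl , star-closed , star-open

  -- A common member of the two stars would contain `p` and `q` and lie in both `X` and `Y`.
  star⊆compl-star : ¬ (Y p × X q) → _⊆_ G (star X p) (compl G (star Y q))
  star⊆compl-star {p = p} {q = q} sep W (lift (cW , W⊆X , Wp)) =
    cW , λ { (lift (_ , W⊆Y , Wq)) → sep (W⊆Y p Wp , W⊆X q Wq) }

  -- Joins and meets from (ii)

  closureOfOpen⇒lattice : ClosureOfOpenIsOpen G → PIsLattice G
  closureOfOpen⇒lattice φ-open x y xP yP = join xP yP , meet
    where
    join : ∀ {x y} → InP G x → InP G y → ∃[ z ] IsJoinP G x y z
    join {x} {y} (collx@(inCx , respx) , _ , _ , x⊆φ̌x) (colly@(inCy , respy) , _ , _ , y⊆φ̌y) =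
      φ G xy ,
      -- A union of open collections is open: a partition into sets outside `xy` is also one into
      -- sets outside `x`, and outside `y`. So (ii) applies to `xy`.
      (φ-isColl , φ-closed , φ-open xy coll (φ̌⊆ , ⊆φ̌)) ,
      (λ X → ⊆φ coll X ∘ inj₁) , (λ X → ⊆φ coll X ∘ inj₂) ,
      λ w (_ , (φw⊆w , _) , _) x⊆w y⊆w X →
        φw⊆w X ∘ φ-mono (λ Y → [ x⊆w Y , y⊆w Y ]′) X
      where
      xy : Coll G
      xy X = x X ⊎ y X
      coll : IsColl G xy
      coll = (λ X → [ inCx X , inCy X ]′) ,
             λ X Y X≐Y → Sum.map (respx X Y X≐Y) (respy X Y X≐Y)
      ⊆φ̌ : _⊆_ G xy (φ̌ G xy)
      ⊆φ̌ X (inj₁ xX) = let cX , ¬φX = x⊆φ̌x X xX in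
        cX , ¬φX ∘ φ-mono (λ Y (cY , ¬xy) → cY , ¬xy ∘ inj₁) X
      ⊆φ̌ X (inj₂ yX) = let cX , ¬φX = y⊆φ̌y X yX in
        cX , ¬φX ∘ φ-mono (λ Y (cY , ¬xy) → cY , ¬xy ∘ inj₂) X
    meet : ∃[ z ] IsMeetP G x y z
    meet with join (compl-inP xP) (compl-inP yP)
    ... | z , zP , x′⊆z , y′⊆z , least =
      compl G z , compl-inP zP ,
      (λ X (cX , ¬zX) → dne λ ¬xX → ¬zX (x′⊆z X (cX , ¬xX))) ,
      (λ X (cX , ¬zX) → dne λ ¬yX → ¬zX (y′⊆z X (cX , ¬yX))) ,
      λ w wP w⊆x w⊆y X wX → proj₁ (proj₁ wP) X wX , λ zX →
        proj₂ (least (compl G w) (compl-inP wP)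
                (λ Y (cY , ¬xY) → cY , ¬xY ∘ w⊆x Y)
                (λ Y (cY , ¬yY) → cY , ¬yY ∘ w⊆y Y) X zX) wX

  -- Crossing partitions obstruct joins

  lattice⇒no-crossing-partitions : PIsLattice G → ∀ {X₁ X₂ Y₁ Y₂} →
    InC G Z → Connected G X₁ → Connected G X₂ → Connected G Y₁ → Connected G Y₂ →
    Disjoint G X₁ X₂ → _≐ᵥ_ G (X₁ ∪ X₂) Z → Disjoint G Y₁ Y₂ → _≐ᵥ_ G (Y₁ ∪ Y₂) Z →
    ∀ {p₁₁ p₁₂ p₂₁ p₂₂} → (X₁ ∩ Y₁) p₁₁ → (X₁ ∩ Y₂) p₁₂ → (X₂ ∩ Y₁) p₂₁ → (X₂ ∩ Y₂) p₂₂ → ⊥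
  lattice⇒no-crossing-partitions {Z} lattice {X₁} {X₂} {Y₁} {Y₂} cZ cX₁ cX₂ cY₁ cY₂ dX X≐Z dY Y≐Z
    {p₁₁} {p₁₂} {p₂₁} {p₂₂} (X₁p₁₁ , Y₁p₁₁) (X₁p₁₂ , Y₂p₁₂) (X₂p₂₁ , Y₁p₂₁) (X₂p₂₂ , Y₂p₂₂)
    with proj₁ (lattice (star X₁ p₁₁) (star X₂ p₂₂) star-inP star-inP)
  ... | c , (_ , (φc⊆c , _) , c-open) , ⊆c₁ , ⊆c₂ , least =
    -- The join `c` contains `X₁` and `X₂`, hence `Z` because it is closed, hence `Y₁` or `Y₂`
    -- because it is open.
    [ notY₁ , notY₂ ]′
      (open-split c-open cZ′ ((p₁₁ , Y₁p₁₁) , cY₁) ((p₂₂ , Y₂p₂₂) , cY₂) dY Y≐Z)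
    where
    cZ′ : c Z
    cZ′ = φc⊆c Z (φ-pair
      (⊆c₁ X₁ (lift (((p₁₁ , X₁p₁₁) , cX₁) , (λ _ → id) , X₁p₁₁)))
      (⊆c₂ X₂ (lift (((p₂₂ , X₂p₂₂) , cX₂) , (λ _ → id) , X₂p₂₂)))
      dX cZ X≐Z)
    -- The stars joined are based in diagonal cells, the excluded stars in the other two. Members of
    -- the star of `X₁` miss `p₂₁`, and members of the star of `X₂` contain `p₂₂`, which is outside
    -- `Y₁`; so the complement of the star of `Y₁` at `p₂₁` is an upper bound without `Y₁`.
    notY₁ : ¬ c Y₁
    notY₁ cY = proj₂
      (least (compl G (star Y₁ p₂₁)) (compl-inP star-inP)
        (star⊆compl-star λ (_ , X₁p₂₁) → dX _ X₁p₂₁ X₂p₂₁)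
        (star⊆compl-star λ (Y₁p₂₂ , _) → dY _ Y₁p₂₂ Y₂p₂₂) Y₁ cY)
      (lift (((p₂₁ , Y₁p₂₁) , cY₁) , (λ _ → id) , Y₁p₂₁))
    notY₂ : ¬ c Y₂
    notY₂ cY = proj₂
      (least (compl G (star Y₂ p₁₂)) (compl-inP star-inP)
        (star⊆compl-star λ (Y₂p₁₁ , _) → dY _ Y₁p₁₁ Y₂p₁₁)
        (star⊆compl-star λ (_ , X₂p₁₂) → dX _ X₁p₁₂ X₂p₁₂) Y₂ cY)
      (lift (((p₁₂ , Y₂p₁₂) , cY₂) , (λ _ → id) , Y₂p₁₂))

  -- Simple paths and cycles

  data Path : V → V → List V → Set where
    [_]  : ∀ u → Path u u (u ∷ [])
    cons : E u v → u ∉ l → Path v w l → Path u w (u ∷ l)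

  path-start : Path u v l → u ∈ l
  path-start [ u ] = here refl
  path-start (cons _ _ _) = here refl

  path-end : Path u v l → v ∈ l
  path-end [ u ] = here refl
  path-end (cons _ _ π) = there (path-end π)

  path-walk : Path u v l → w ∈ l → WalkIn G (_∈ l) w v
  path-walk [ u ] (here refl) = here
  path-walk (cons e _ π) (here refl) =
    step e (there (path-start π)) (walk-mono (λ _ → there) (path-walk π (path-start π)))
  path-walk (cons _ _ π) (there w∈l) = walk-mono (λ _ → there) (path-walk π w∈l)

  path-connected : Path u v l → Connected G (_∈ l)
  path-connected π = connected-from λ _ → path-walk π

  path-++ : Path u v l → E v w → Path w z m → (∀ {x} → x ∈ l → x ∉ m) → Path u z (l ++ m)
  path-++ [ u ] e ρ dis = cons e (dis (here refl)) ρ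
  path-++ (cons {l = l} e′ u∉l π) e ρ dis =
    cons e′ ([ u∉l , dis (here refl) ]′ ∘ ∈-++⁻ l) (path-++ π e ρ (dis ∘ there))

  path-suffix : Path u v l → w ∈ l → ∃[ m ] (Path w v m × (∀ {x} → x ∈ m → x ∈ l))
  path-suffix π@([ u ]) (here refl) = _ , π , id
  path-suffix π@(cons _ _ _) (here refl) = _ , π , id
  path-suffix (cons _ _ π) (there w∈l) =
    Product.map₂ (Product.map₂ λ m⊆l x∈m → there (m⊆l x∈m)) (path-suffix π w∈l)

  -- Loop erasure: if `u` recurs on the path built from the rest of the walk, the suffix from that
  -- recurrence is taken instead.
  walk⇒path : X u → WalkIn G X u v → ∃[ l ] (Path u v l × (∀ {x} → x ∈ l → X x))
  walk⇒path {u = u} Xu here = _ , [ u ] , λ { (here refl) → Xu }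
  walk⇒path {u = u} Xu (step e Xw ws) with walk⇒path Xw ws
  ... | l , π , l⊆X with lem {P = u ∈ l}
  ...   | yes u∈l = Product.map₂ (Product.map₂ λ m⊆l x∈m → l⊆X (m⊆l x∈m)) (path-suffix π u∈l)
  ...   | no u∉l = _ , cons e u∉l π , λ { (here refl) → Xu ; (there x∈l) → l⊆X x∈l }

  _∖_ : List V → V → VSet G
  (l ∖ x) w = w ∈ l × w ≢ x

  -- Deleting `x` leaves at most two pieces of the path, one keeping the start and one keeping the
  -- end; `w` lies in one of them.
  path-avoid : ∀ x → Path u v l → w ∈ l → w ≢ x →
               (u ≢ x × WalkIn G (l ∖ x) u w) ⊎ (v ≢ x × WalkIn G (l ∖ x) w v)
  path-avoid x [ u ] (here refl) u≢x = inj₁ (u≢x , here)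
  path-avoid x (cons e u∉l π) (here refl) u≢x = inj₁ (u≢x , here)
  path-avoid {u} x (cons e u∉l π) (there w∈l) w≢x with path-avoid x π w∈l w≢x
  ... | inj₂ (v≢x , ws) = inj₂ (v≢x , walk-mono (λ _ → Product.map₁ there) ws)
  ... | inj₁ (u′≢x , ws) with lem {P = u ≡ x}
  ...   | no u≢x = inj₁ (u≢x , step e (there (path-start π) , u′≢x)
                                 (walk-mono (λ _ → Product.map₁ there) ws))
  -- The start is deleted. It does not recur, so the rest of the path leads from `w` to the end
  -- intact.
  ...   | yes refl =
    inj₂ ((λ { refl → u∉l (path-end π) }) ,
          walk-mono (λ _ a∈l → there a∈l , λ { refl → u∉l a∈l }) (path-walk π w∈l))

  -- After a deletion every remaining vertex still reaches a surviving end of the path; if two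
  -- vertices reach different ends, the closing edge connects them.
  cycle-biconnected : Path u v l → E v u → Biconnected G (_∈ l)
  cycle-biconnected {u} {v} {l} π e =
    ((u , path-start π) , path-connected π) , λ x _ → connected x
    where
    u∈ : u ∈ l
    u∈ = path-start π
    v∈ : v ∈ l
    v∈ = path-end π
    connected : ∀ x → Connected G (l ∖ x)
    connected x a b a∈@(a∈l , a≢x) b∈@(b∈l , b≢x)
      with path-avoid x π a∈l a≢x | path-avoid x π b∈l b≢x
    ... | inj₁ (u≢x , ua) | inj₁ (_ , ub) = walk-++ (walk-reverse (u∈ , u≢x) ua) ub
    ... | inj₁ (u≢x , ua) | inj₂ (v≢x , bv) =
      walk-++ (walk-reverse (u∈ , u≢x) ua)
              (step (E-sym e) (v∈ , v≢x) (walk-reverse b∈ bv))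
    ... | inj₂ (v≢x , av) | inj₁ (u≢x , ub) = walk-++ av (step e (u∈ , u≢x) ub)
    ... | inj₂ (_ , av) | inj₂ (_ , bv) = walk-++ av (walk-reverse b∈ bv)

  -- Long cycles, 4-cliques and biconnected sets under (i)

  lattice⇒no-long-cycle : PIsLattice G → ∀ {p₀ p₁ p₂ p₃ l} →
    E p₃ p₀ → p₃ ∉ p₀ ∷ p₁ ∷ l → E p₀ p₁ → p₀ ∉ p₁ ∷ l → E p₁ p₂ → p₁ ∉ l →
    Path p₂ v l → E v p₃ → ⊥
  lattice⇒no-long-cycle {v} lattice {p₀} {p₁} {p₂} {p₃} {l} e₃₀ p₃∉ e₀₁ p₀∉ e₁₂ p₁∉ π eᵥ₃ =
    -- The cycle is cut into two arcs in two ways. The cells are the singletons of `p₀`, `p₃`, `p₁`,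
    -- and `l`, which contains `p₂`. Chords are allowed, which is how a 4-clique qualifies.
    lattice⇒no-crossing-partitions lattice
      {X₁ = _∈ p₃ ∷ p₀ ∷ []} {X₂ = _∈ p₁ ∷ l} {Y₁ = _∈ p₀ ∷ p₁ ∷ []} {Y₂ = _∈ p₃ ∷ l}
      ((p₃ , here refl) , path-connected (cons e₃₀ p₃∉ (cons e₀₁ p₀∉ path₁)))
      (path-connected (cons e₃₀ (λ { (here refl) → p₃∉ (here refl) }) [ p₀ ]))
      (path-connected path₁)
      (path-connected (cons e₀₁ (λ { (here refl) → p₀∉ (here refl) }) [ p₁ ]))
      -- In this arc `p₃` heads the list but is attached to the far end `v` of the path, so all
      -- walks are directed to `p₃` through `v`.
      (connected-from λ
        { _ (here refl) → here
        ; w (there w∈l) → walk-++ (walk-mono (λ _ → there) (path-walk π w∈l))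
                                  (step eᵥ₃ (here refl) here) })
      (λ { _ (here refl) v∈ → p₃∉ (there v∈) ; _ (there (here refl)) v∈ → p₀∉ v∈ })
      ((λ { _ (inj₁ (here refl)) → here refl
          ; _ (inj₁ (there (here refl))) → there (here refl)
          ; _ (inj₂ v∈) → there (there v∈) }) ,
       (λ { _ (here refl) → inj₁ (here refl)
          ; _ (there (here refl)) → inj₁ (there (here refl))
          ; _ (there (there v∈)) → inj₂ v∈ }))
      (λ { _ (here refl) (here refl) → p₃∉ (here refl)
         ; _ (here refl) (there v∈) → p₀∉ (there v∈)
         ; _ (there (here refl)) (here refl) → p₃∉ (there (here refl))
         ; _ (there (here refl)) (there v∈) → p₁∉ v∈ })
      ((λ { _ (inj₁ (here refl)) → there (here refl)
          ; _ (inj₁ (there (here refl))) → there (there (here refl))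
          ; _ (inj₂ (here refl)) → here refl
          ; _ (inj₂ (there v∈)) → there (there (there v∈)) }) ,
       (λ { _ (here refl) → inj₂ (here refl)
          ; _ (there (here refl)) → inj₁ (here refl)
          ; _ (there (there (here refl))) → inj₁ (there (here refl))
          ; _ (there (there (there v∈))) → inj₂ (there v∈) }))
      (there (here refl) , here refl) (here refl , here refl)
      (here refl , there (here refl)) (there (path-start π) , there (path-start π))
    where
    path₁ : Path p₁ v (p₁ ∷ l)
    path₁ = cons e₁₂ p₁∉ π

  E⇒≢ : E u v → u ≢ v
  E⇒≢ e refl = E-irr e

  lattice⇒no4Clique : PIsLattice G → ¬ Has4Clique G
  lattice⇒no4Clique lattice (a , b , c , d , ab , ac , ad , bc , bd , cd) =
    lattice⇒no-long-cycle lattice (E-sym ad)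
      (λ { (here refl) → E-irr ad ; (there (here refl)) → E-irr bd
         ; (there (there (here refl))) → E-irr cd })
      ab (λ { (here refl) → E-irr ab ; (there (here refl)) → E-irr ac })
      bc (λ { (here refl) → E-irr bc }) [ c ] cd

  -- A nonadjacent pair at distance two in X, joined avoiding the midpoint by
  -- biconnectedness, lies on a cycle with at least four vertices.
  lattice⇒blockGraph : PIsLattice G → IsBlockGraph G
  lattice⇒blockGraph lattice X ((_ , conX) , bi) u v Xu Xv u≢v = dne λ ¬uv →
    -- The walk to `v` must leave the closed neighbourhood of `u`; the edge by which it does so
    -- gives the midpoint `m` and the far vertex `b`.
    let m , b , Xm , m∈N , Xb , b∉N , mb =
          exit-edge {P = λ w → w ≡ u ⊎ E u w} Xu (inj₁ refl)
            [ u≢v ∘ sym , ¬uv ]′ (conX u v Xu Xv)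
    in long-cycle Xm m∈N Xb b∉N mb
    where
    long-cycle : ∀ {m b} → X m → m ≡ u ⊎ E u m → X b → ¬ (b ≡ u ⊎ E u b) → E m b → ⊥
    long-cycle Xm (inj₁ refl) Xb b∉N mb = b∉N (inj₂ mb)
    long-cycle {m} {b} Xm (inj₂ um) Xb b∉N mb
      with walk⇒path (Xu , E⇒≢ um)
             (bi m Xm u b (Xu , E⇒≢ um) (Xb , E⇒≢ mb ∘ sym))
    ... | _ , [ _ ] , _ = b∉N (inj₁ refl)
    ... | _ , cons ub _ [ _ ] , _ = b∉N (inj₂ ub)
    ... | _ , cons e₀₁ p₀∉ (cons e₁₂ p₁∉ π) , avoids =
      lattice⇒no-long-cycle lattice (E-sym um) (λ m∈ → proj₂ (avoids m∈) refl)
        e₀₁ p₀∉ e₁₂ p₁∉ π (E-sym mb)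

  -- Closures of open collections in block graphs

  module BlockGraph (block : IsBlockGraph G) where

    -- A path from `a` to `a′` in `Y₁` and one from `b′` to `b` in `Y₂` close up through the two
    -- crossing edges. The resulting vertex set is biconnected, even when ends coincide and a path
    -- is a single vertex.
    crossing-clique : ∀ {Y₁ Y₂ a a′ b b′} →
      Connected G Y₁ → Connected G Y₂ → Disjoint G Y₁ Y₂ →
      Y₁ a → Y₁ a′ → Y₂ b → Y₂ b′ → E a b → E a′ b′ →
      ∃[ C ] (Clique G C × C a × C a′ × C b × C b′)
    crossing-clique {a = a} {a′} {b} {b′} con₁ con₂ dis Y₁a Y₁a′ Y₂b Y₂b′ ab a′b′
      with walk⇒path Y₁a (con₁ a a′ Y₁a Y₁a′) | walk⇒path Y₂b′ (con₂ b′ b Y₂b′ Y₂b)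
    ... | l , π , l⊆Y₁ | m , ρ , m⊆Y₂ =
      (_∈ l ++ m) ,
      block _ (cycle-biconnected
        (path-++ π a′b′ ρ (λ x∈l x∈m → dis _ (l⊆Y₁ x∈l) (m⊆Y₂ x∈m))) (E-sym ab)) ,
      ∈-++⁺ˡ (path-start π) , ∈-++⁺ˡ (path-end π) ,
      ∈-++⁺ʳ l (path-end ρ) , ∈-++⁺ʳ l (path-start ρ)

    module _ {X Y₁ Y₂ : VSet G} (con₁ : Connected G Y₁) (con₂ : Connected G Y₂)
             (dis : Disjoint G Y₁ Y₂) (X⊆ : _⊆ᵥ_ G X (Y₁ ∪ Y₂)) where

      -- Each excursion of a walk into Y₂ is replaced by the edge, if any,
      -- between the vertices of Y₁ around it.
      walk-∩ : Y₁ v → Y₁ u → WalkIn G X u v → WalkIn G (X ∩ Y₁) u v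
      -- Here `u` is the vertex of departure, `p` the entry point into `Y₂` and `w` the current
      -- vertex; the edge from `u` to `p` is kept for `crossing-clique` on return.
      excursion : Y₁ v → Y₁ u → Y₂ p → E u p → Y₂ w → WalkIn G X w v →
                  WalkIn G (X ∩ Y₁) u v

      walk-∩ Y₁v Y₁u here = here
      walk-∩ Y₁v Y₁u (step e Xw ws) with X⊆ _ Xw
      ... | inj₁ Y₁w = step e (Xw , Y₁w) (walk-∩ Y₁v Y₁w ws)
      ... | inj₂ Y₂w = excursion Y₁v Y₁u Y₂w e Y₂w ws

      excursion Y₁v Y₁u Y₂p up Y₂w here = ⊥-elim (dis _ Y₁v Y₂w)
      excursion {u = u} Y₁v Y₁u Y₂p up Y₂w (step {w = w′} e Xw′ ws) with X⊆ _ Xw′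
      ... | inj₂ Y₂w′ = excursion Y₁v Y₁u Y₂p up Y₂w′ ws
      ... | inj₁ Y₁w′ with lem {P = u ≡ w′}
      ...   | yes refl = walk-∩ Y₁v Y₁u ws
      ...   | no u≢w′
        with crossing-clique con₁ con₂ dis Y₁u Y₁w′ Y₂p Y₂w up (E-sym e)
      ...     | _ , clique , Cu , Cw′ , _ =
        step (clique _ _ Cu Cw′ u≢w′) (Xw′ , Y₁w′) (walk-∩ Y₁v Y₁w′ ws)

      connected-∩ : Connected G X → Connected G (X ∩ Y₁)
      connected-∩ conX a b (Xa , Y₁a) (Xb , Y₁b) = walk-∩ Y₁b Y₁a (conX a b Xa Xb)

    module _ (¬K₄ : ¬ Has4Clique G) {u : Coll G} (coll : IsColl G u) (u-open : Open G u)
             {Y₁ Y₂ : VSet G} (con₁ : Connected G Y₁) (con₂ : Connected G Y₂)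
             (dis : Disjoint G Y₁ Y₂) where

      Meets : VSet G → VSet G → Set
      Meets X Y = ∃[ v ] (X ∩ Y) v

      Cut : VSet G → Set
      Cut X = Meets X Y₁ × Meets X Y₂

      -- Parts missing `Y` are exempt because an empty trace is not in `𝒞`; the nonempty traces of
      -- retained parts will partition `Y`.
      Retained : VSet G → VSet G → Set₁
      Retained Y X = Meets X Y → u (X ∩ Y)

      cut-edge : Connected G X → _⊆ᵥ_ G X (Y₁ ∪ Y₂) → Cut X →
                 ∃[ a ] ∃[ b ] ((X ∩ Y₁) a × (X ∩ Y₂) b × E a b)
      cut-edge conX X⊆ ((p , Xp , Y₁p) , (q , Xq , Y₂q))
        with exit-edge {P = Y₁} Xp Y₁p (λ Y₁q → dis q Y₁q Y₂q) (conX p q Xp Xq)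
      ... | a , b , Xa , Y₁a , Xb , ¬Y₁b , e =
        a , b , (Xa , Y₁a) , (Xb , [ (λ Y₁b → contradiction Y₁b ¬Y₁b) , id ]′ (X⊆ b Xb)) , e

      cut-unique : ∀ {X X′} → Connected G X → Connected G X′ →
                   _⊆ᵥ_ G X (Y₁ ∪ Y₂) → _⊆ᵥ_ G X′ (Y₁ ∪ Y₂) →
                   Disjoint G X X′ → Cut X → Cut X′ → ⊥
      cut-unique {X} {X′} conX conX′ X⊆ X′⊆ XX′ cutX cutX′
        with cut-edge conX X⊆ cutX | cut-edge conX′ X′⊆ cutX′
      ... | a , b , (Xa , Y₁a) , (Xb , Y₂b) , ab | a′ , b′ , (X′a′ , Y₁a′) , (X′b′ , Y₂b′) , a′b′
        with crossing-clique con₁ con₂ dis Y₁a Y₁a′ Y₂b Y₂b′ ab a′b′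
      ... | C , clique , Ca , Ca′ , Cb , Cb′ =
        ¬K₄ (a , a′ , b , b′ , clique a a′ Ca Ca′ a≢a′ , ab ,
             clique a b′ Ca Cb′ (λ { refl → dis a Y₁a Y₂b′ }) ,
             clique a′ b Ca′ Cb (λ { refl → dis b Y₁a′ Y₂b }) , a′b′ ,
             clique b b′ Cb Cb′ b≢b′)
        where
        a≢a′ : a ≢ a′
        a≢a′ refl = XX′ a Xa X′a′
        b≢b′ : b ≢ b′
        b≢b′ refl = XX′ b Xb X′b′

      -- An uncut part that meets one side lies inside it, so its trace there is the part itself.
      uncut-retained : u X → _⊆ᵥ_ G X (Y₁ ∪ Y₂) → ¬ Cut X →
                       Retained Y₁ X × Retained Y₂ X
      uncut-retained {X} uX X⊆ ¬cut =
        (λ meets₁ → proj₂ coll X (X ∩ Y₁)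
          ((λ v Xv → Xv , [ id , (λ Y₂v → ⊥-elim (¬cut (meets₁ , v , Xv , Y₂v))) ]′ (X⊆ v Xv)) ,
           (λ v → proj₁)) uX) ,
        (λ meets₂ → proj₂ coll X (X ∩ Y₂)
          ((λ v Xv → Xv , [ (λ Y₁v → ⊥-elim (¬cut ((v , Xv , Y₁v) , meets₂))) , id ]′ (X⊆ v Xv)) ,
           (λ v → proj₁)) uX)

      cut-retained : u X → _⊆ᵥ_ G X (Y₁ ∪ Y₂) → Cut X → Retained Y₁ X ⊎ Retained Y₂ X
      cut-retained {X} uX X⊆ (meets₁ , meets₂) =
        Sum.map (λ u₁ _ → u₁) (λ u₂ _ → u₂)
          (open-split u-open uX
            (meets₁ , connected-∩ con₁ con₂ dis X⊆ conX)
            (meets₂ , connected-∩ con₂ con₁ (λ v Y₂v Y₁v → dis v Y₁v Y₂v)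
                        (λ v → Sum.swap ∘ X⊆ v) conX)
            (λ v (_ , Y₁v) (_ , Y₂v) → dis v Y₁v Y₂v)
            ((λ v → [ proj₁ , proj₁ ]′) ,
             (λ v Xv → Sum.map (Xv ,_) (Xv ,_) (X⊆ v Xv))))
        where
        conX : Connected G X
        conX = proj₂ (proj₁ coll X uX)

      uncut-all : (Xs : List (VSet G)) → AllIn G u Xs → _⊆ᵥ_ G (⋃ G Xs) (Y₁ ∪ Y₂) →
                  u X → _⊆ᵥ_ G X (Y₁ ∪ Y₂) → Cut X → Disjoint G X (⋃ G Xs) →
                  All (λ X → Retained Y₁ X × Retained Y₂ X) Xs
      uncut-all [] _ _ _ _ _ _ = []
      uncut-all {X} (X′ ∷ Xs) (uX′ , a) ⊆Y uX X⊆ cut XX′ =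
        uncut-retained uX′ (λ v → ⊆Y v ∘ inj₁)
          (cut-unique (proj₂ (proj₁ coll X uX)) (proj₂ (proj₁ coll X′ uX′)) X⊆
            (λ v → ⊆Y v ∘ inj₁) (λ v Xv → XX′ v Xv ∘ inj₁) cut) ∷
        uncut-all Xs a (λ v → ⊆Y v ∘ inj₂) uX X⊆ cut (λ v Xv → XX′ v Xv ∘ inj₂)

      -- Uncut parts are retained on both sides, so only the first cut part found decides the side;
      -- all later parts are then uncut.
      all-retained : (Xs : List (VSet G)) → AllIn G u Xs → PairwiseDisjoint G Xs →
                     _⊆ᵥ_ G (⋃ G Xs) (Y₁ ∪ Y₂) →
                     All (Retained Y₁) Xs ⊎ All (Retained Y₂) Xs
      -- No cut part was met, so the choice of side is arbitrary.
      all-retained [] _ _ _ = inj₁ []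
      all-retained (X ∷ Xs) (uX , a) (dX , d) ⊆Y with lem {P = Cut X}
      ... | no ¬cut =
        let r₁ , r₂ = uncut-retained uX (λ v → ⊆Y v ∘ inj₁) ¬cut in
        Sum.map (r₁ ∷_) (r₂ ∷_) (all-retained Xs a d (λ v → ⊆Y v ∘ inj₂))
      ... | yes cut =
        let rs = uncut-all Xs a (λ v → ⊆Y v ∘ inj₂) uX (λ v → ⊆Y v ∘ inj₁) cut dX in
        Sum.map (_∷ All.map proj₁ rs) (_∷ All.map proj₂ rs)
          (cut-retained uX (λ v → ⊆Y v ∘ inj₁) cut)

      restrict : ∀ Y (Xs : List (VSet G)) → All (Retained Y) Xs → PairwiseDisjoint G Xs →
                 ∃[ Ys ] (AllIn G u Ys × PairwiseDisjoint G Ys × _≐ᵥ_ G (⋃ G Ys) (⋃ G Xs ∩ Y))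
      restrict Y [] [] _ = [] , lift tt , tt , (λ _ ()) , (λ { _ (() , _) })
      restrict Y (X ∷ Xs) (r ∷ rs) (dX , d) with restrict Y Xs rs d | lem {P = Meets X Y}
      ... | Ys , a , e , Ys⊆ , ⊆Ys | yes meets =
        (X ∩ Y) ∷ Ys , (r meets , a) ,
        ((λ v (Xv , _) Ysv → dX v Xv (proj₁ (Ys⊆ v Ysv))) , e) ,
        (λ v → [ Product.map₁ inj₁ , Product.map₁ inj₂ ∘ Ys⊆ v ]′) ,
        (λ { v (inj₁ Xv , Yv) → inj₁ (Xv , Yv)
           ; v (inj₂ Xsv , Yv) → inj₂ (⊆Ys v (Xsv , Yv)) })
      ... | Ys , a , e , Ys⊆ , ⊆Ys | no ¬meets =
        Ys , a , e , (λ v → Product.map₁ inj₂ ∘ Ys⊆ v) ,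
        (λ { v (inj₁ Xv , Yv) → ⊥-elim (¬meets (v , Xv , Yv))
           ; v (inj₂ Xsv , Yv) → ⊆Ys v (Xsv , Yv) })

      φ-restrict : InC G Y → (Xs : List (VSet G)) → PairwiseDisjoint G Xs →
                   _⊆ᵥ_ G Y (⋃ G Xs) → All (Retained Y) Xs → φ G u Y
      φ-restrict {Y} cY@((v , Yv) , _) Xs d Y⊆ rs with restrict Y Xs rs d
      ... | Ys , a , e , Ys⊆ , ⊆Ys =
        cY , Ys , ⋃-nonempty Ys (⊆Ys v (Y⊆ v Yv , Yv)) , a , e ,
        (λ w → proj₂ ∘ Ys⊆ w) , (λ w Yw → ⊆Ys w (Y⊆ w Yw , Yw))

      φ-split : InC G Y₁ → InC G Y₂ → φ G u (Y₁ ∪ Y₂) → φ G u Y₁ ⊎ φ G u Y₂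
      φ-split c₁ c₂ (_ , Xs , _ , a , d , ⋃⊆ , ⊆⋃) =
        Sum.map (φ-restrict c₁ Xs d (λ v → ⊆⋃ v ∘ inj₁))
                (φ-restrict c₂ Xs d (λ v → ⊆⋃ v ∘ inj₂))
                (all-retained Xs a d ⋃⊆)

  -- Openness of `φ G u` amounts to closedness of its complement; by the two-part criterion this is
  -- the contrapositive of `φ-split`.
  blockGraph⇒closureOfOpen : BlockGraphNo4Clique G → ClosureOfOpenIsOpen G
  blockGraph⇒closureOfOpen (block , ¬K₄) u coll u-open =
    φ̌⊆ , λ X φX → proj₁ φX , λ φ¬φX → proj₂ (compl-closed X φ¬φX) φX
    where
    open BlockGraph block
    compl-closed : _⊆_ G (φ G (compl G (φ G u))) (compl G (φ G u))
    compl-closed = φ⊆-binary-closed (compl-isColl φ-isColl)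
      λ Y₁ Y₂ (c₁ , ¬φ₁) (c₂ , ¬φ₂) dis c₁₂ → c₁₂ ,
        [ ¬φ₁ , ¬φ₂ ]′ ∘ φ-split ¬K₄ coll u-open (proj₂ c₁) (proj₂ c₂) dis c₁ c₂

theorem14p1 : (lem : ∀ {ℓ} → ExcludedMiddle ℓ) → (G : Graph) →
    (PIsLattice G ⇔ ClosureOfOpenIsOpen G) × (ClosureOfOpenIsOpen G ⇔ BlockGraphNo4Clique G)
theorem14p1 lem G =
  -- Both equivalences are read off the cycle (i) ⇒ (iii) ⇒ (ii) ⇒ (i).
  mk⇔ (blockGraph⇒closureOfOpen ∘ lattice⇒block) closureOfOpen⇒lattice ,
  mk⇔ (lattice⇒block ∘ closureOfOpen⇒lattice) blockGraph⇒closureOfOpen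
  where
  open Proof lem G
  lattice⇒block : PIsLattice G → BlockGraphNo4Clique G
  lattice⇒block lattice = lattice⇒blockGraph lattice , lattice⇒no4Clique lattice
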